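{- For all integers $n\geq 0$, $i\geq 1$ and $\alpha\geq 0$, $\bar a_{2i}\big(2^\alpha(4n+3)\big)\equiv 0 \pmod 4$.
   Context: For an integer $k\geq 1$ let $f_k:=\prod_{n\geq 1}(1-q^{kn})$. For an integer $c\geq1$, the generalized overcubic partition function $\bar a_c(n)$ is defined by the generating function $\sum_{n\geq 0}\bar a_c(n)q^n=\dfrac{f_4^{c-1}}{f_1^2f_2^{2c-3}}$. -}

module Defs where

open import Algebra.Bundles.Raw using (RawMonoid)
open import Data.Bool.Base using (if_then_else_)
open import Data.Fin.Base using (Fin; toℕ)
open import Data.Integer.Base using (ℤ; +_; -[1+_]; _+_; _-_; _*_; -_; 0ℤ; 1ℤ)
open import Data.Integer.Properties
  using (+-*-semiring; *-identityˡ; *-identityʳ; *-zeroʳ; +-identityˡ; +-identityʳ; +-inverseˡ)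
open import Data.Nat.Base as ℕ using (ℕ; zero; suc; _∸_; _≤_; _<_; s≤s; _≡ᵇ_)
import Data.Nat.Properties as ℕ
open import Data.Vec.Base using (Vec; []; _∷_; head; lookup)
open import Level using (0ℓ)
open import Relation.Binary.PropositionalEquality
  using (_≡_; _≗_; refl; sym; trans; cong; cong₂; module ≡-Reasoning)
open import Algebra.Properties.Semiring.Sum +-*-semiring using (sum; sum-cong-≗)

-- Formal power series over ℤ, as coefficient sequences.
Series : Set
Series = ℕ → ℤ

infixl 6 _⊖_
infixl 7 _⊛_

q^_ : ℕ → Series
(q^ j) m = if m ≡ᵇ j then 1ℤ else 0ℤ

𝟙 : Series
𝟙 = q^ 0

_⊖_ : Series → Series → Series
(a ⊖ b) m = a m - b m

_⊛_ : Series → Series → Series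
(a ⊛ b) m = sum {suc m} (λ i → a (toℕ i) * b (m ∸ toℕ i))

⊛-rawMonoid : RawMonoid 0ℓ 0ℓ
⊛-rawMonoid = record { Carrier = Series ; _≈_ = _≗_ ; _∙_ = _⊛_ ; ε = 𝟙 }

open import Algebra.Definitions.RawMonoid ⊛-rawMonoid using (_×_)

infixr 8 _^ˢ_
_^ˢ_ : Series → ℕ → Series
a ^ˢ n = n × a

-- The coefficients bₘ, …, b₁, b₀ (in this order) of the inverse of a series
-- a = 1 + a₁q + a₂q² + ⋯, obtained from bₘ₊₁ = - (a₁bₘ + ⋯ + aₘ₊₁b₀).
recipCoeffs : Series → (m : ℕ) → Vec ℤ (suc m)
recipCoeffs a zero    = 1ℤ ∷ []
recipCoeffs a (suc m) =
  - sum (λ i → a (suc (toℕ i)) * lookup (recipCoeffs a m) i) ∷ recipCoeffs a m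

-- Multiplicative inverse; meaningful for series with constant term 1
-- (see ⊛-recip).
recip : Series → Series
recip a m = head (recipCoeffs a m)

infixr 8 _^ᶻ_
_^ᶻ_ : Series → ℤ → Series
a ^ᶻ (+ n)    = a ^ˢ n
a ^ᶻ -[1+ n ] = recip a ^ˢ suc n

-- g 1 ⊛ g 2 ⊛ ⋯ ⊛ g N
∏≤ : ℕ → (ℕ → Series) → Series
∏≤ zero    g = 𝟙
∏≤ (suc N) g = ∏≤ N g ⊛ g (suc N)

-- ∏_{n ≥ 1} g n, for g with g n ≡ 1 modulo qⁿ: only the first m factors
-- affect the coefficient of qᵐ (see ∏≤-stable).
∏∞ : (ℕ → Series) → Series
∏∞ g m = ∏≤ m g m

-- Only used for k ≥ 1.
f : ℕ → Series
f k = ∏∞ (λ n → 𝟙 ⊖ q^ (k ℕ.* n))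

-- For c ≥ 1. The exponents are integers: 2c - 3 is negative for c = 1.
overcubicGF : ℕ → Series
overcubicGF c =
  f 4 ^ᶻ (+ c - + 1) ⊛ recip (f 1 ^ˢ 2 ⊛ f 2 ^ᶻ (+ (2 ℕ.* c) - + 3))

ā : ℕ → ℕ → ℤ
ā c n = overcubicGF c n

------------------------------------------------------------------------
-- The definitions of recip, ∏∞ and f are adequate

private
  lookup-recipCoeffs : ∀ a m i → lookup (recipCoeffs a m) i ≡ recip a (m ∸ toℕ i)
  lookup-recipCoeffs a zero    Fin.zero    = refl
  lookup-recipCoeffs a (suc m) Fin.zero    = refl
  lookup-recipCoeffs a (suc m) (Fin.suc i) = lookup-recipCoeffs a m i

⊛-recip : ∀ a → a 0 ≡ 1ℤ → a ⊛ recip a ≗ 𝟙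
⊛-recip a a₀ zero    rewrite a₀ = refl
⊛-recip a a₀ (suc m) = begin
  a 0 * - S + sum {suc m} (λ i → a (suc (toℕ i)) * recip a (m ∸ toℕ i))
    ≡⟨ cong₂ (λ x y → x * - S + y) a₀
         (sum-cong-≗ {suc m} (λ i → cong (a (suc (toℕ i)) *_) (sym (lookup-recipCoeffs a m i)))) ⟩
  1ℤ * - S + S ≡⟨ cong (_+ S) (*-identityˡ (- S)) ⟩
  - S + S      ≡⟨ +-inverseˡ S ⟩
  0ℤ           ∎
  where
  open ≡-Reasoning
  S = sum {suc m} (λ i → a (suc (toℕ i)) * lookup (recipCoeffs a m) i)

private
  ⊛-congʳ-≤ : ∀ a {b c} m → (∀ j → j ≤ m → b j ≡ c j) → (a ⊛ b) m ≡ (a ⊛ c) m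
  ⊛-congʳ-≤ a m b≡c =
    sum-cong-≗ {suc m} (λ i → cong (a (toℕ i) *_) (b≡c _ (ℕ.m∸n≤m m (toℕ i))))

⊛-identityʳ : ∀ a → a ⊛ 𝟙 ≗ a
⊛-identityʳ a zero    = trans (+-identityʳ _) (*-identityʳ (a 0))
⊛-identityʳ a (suc m) = begin
  a 0 * 0ℤ + ((λ j → a (suc j)) ⊛ 𝟙) m
    ≡⟨ cong₂ _+_ (*-zeroʳ (a 0)) (⊛-identityʳ (λ j → a (suc j)) m) ⟩
  0ℤ + a (suc m) ≡⟨ +-identityˡ _ ⟩
  a (suc m)      ∎
  where open ≡-Reasoning

∏≤-stable : ∀ g → (∀ n j → j < n → g n j ≡ 𝟙 j) →
            ∀ {m N} → m ≤ N → ∏≤ N g m ≡ ∏∞ g m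
∏≤-stable g g≡1 m≤N = go (ℕ.≤⇒≤′ m≤N)
  where
  go : ∀ {m N} → m ℕ.≤′ N → ∏≤ N g m ≡ ∏∞ g m
  go ℕ.≤′-refl = refl
  go {m} (ℕ.≤′-step {N} m≤′N) = begin
    (∏≤ N g ⊛ g (suc N)) m
      ≡⟨ ⊛-congʳ-≤ (∏≤ N g) m
           (λ j j≤m → g≡1 (suc N) j (s≤s (ℕ.≤-trans j≤m (ℕ.≤′⇒≤ m≤′N)))) ⟩
    (∏≤ N g ⊛ 𝟙) m ≡⟨ ⊛-identityʳ (∏≤ N g) m ⟩
    ∏≤ N g m       ≡⟨ go m≤′N ⟩
    ∏∞ g m         ∎
    where open ≡-Reasoning

f-stable : ∀ k .{{_ : ℕ.NonZero k}} {m N} → m ≤ N →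
           ∏≤ N (λ n → 𝟙 ⊖ q^ (k ℕ.* n)) m ≡ f k m
f-stable k = ∏≤-stable (λ n → 𝟙 ⊖ q^ (k ℕ.* n)) factor≡1
  where
  q^-< : ∀ {j n} → j < n → (q^ n) j ≡ 0ℤ
  q^-< {zero}  (s≤s _)   = refl
  q^-< {suc j} (s≤s j<n) = q^-< {j} j<n

  factor≡1 : ∀ n j → j < n → (𝟙 ⊖ q^ (k ℕ.* n)) j ≡ 𝟙 j
  factor≡1 n j j<n
    rewrite q^-< {j} (ℕ.<-≤-trans j<n (ℕ.m≤n*m n k)) = +-identityʳ (𝟙 j)

-- The series passed to recip in overcubicGF do have constant term 1.
private
  ⊛-const : ∀ a b → a 0 ≡ 1ℤ → b 0 ≡ 1ℤ → (a ⊛ b) 0 ≡ 1ℤ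
  ⊛-const a b a₀ b₀ rewrite a₀ | b₀ = refl

  ^-const : ∀ a n → a 0 ≡ 1ℤ → (a ^ˢ n) 0 ≡ 1ℤ
  ^-const a zero    a₀ = refl
  ^-const a (suc n) a₀ = ⊛-const a (a ^ˢ n) a₀ (^-const a n a₀)

^ᶻ-const : ∀ a z → a 0 ≡ 1ℤ → (a ^ᶻ z) 0 ≡ 1ℤ
^ᶻ-const a (+ n)    a₀ = ^-const a n a₀
^ᶻ-const a -[1+ n ] a₀ = ^-const (recip a) (suc n) refl

denominator-const : ∀ z → (f 1 ^ˢ 2 ⊛ f 2 ^ᶻ z) 0 ≡ 1ℤ
denominator-const z = ⊛-const (f 1 ^ˢ 2) (f 2 ^ᶻ z) refl (^ᶻ-const (f 2) z refl)

{-# OPTIONS --safe #-}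

-- Put P k = f (2k) / (f k)². Since 1 - x² = (1 - x)² (1 + 2x/(1 - x)), P k is the
-- product of the factors 1 + 2 q^(kn)/(1 - q^(kn)), so modulo 4 its coefficient
-- at N > 0 is twice the number of pairs (a , b) with k a b = N. This number is
-- even unless N = k a² for some a, because of the involution (a , b) ↦ (b , a).
-- The generating function for c = 2 + d is P 1 · (P 2)^(1 + d), and
-- 2^α (4n + 3) is neither a square nor twice a square.

module Submission where

open import Defs
open import Data.Integer.Base using (+_)
open import Data.Integer.Divisibility using (_∣_)
open import Data.Nat.Base using (ℕ; _+_; _*_; _^_; _≤_)

open import Algebra.Bundles using (CommutativeSemiring)
import Algebra.Construct.Pointwise as Pointwise
import Algebra.Properties.CommutativeMonoid.Mult as Power
import Algebra.Properties.Monoid.Mult as Multiple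
import Algebra.Properties.Ring as RingProperties
import Algebra.Solver.Ring.NaturalCoefficients.Default as Solver
open import Algebra.Structures using (IsCommutativeMonoid)
open import Algebra.Structures.Biased using (isCommutativeSemiringˡ)
open import Data.Bool.Base using (if_then_else_)
open import Data.Fin.Base as Fin using (Fin; toℕ)
import Data.Fin.Properties as Fin
open import Data.Integer.Base as ℤ using (ℤ; 0ℤ; 1ℤ)
import Data.Integer.Divisibility.Signed as Signed
import Data.Integer.Properties as ℤ
import Data.Integer.Solver as ℤSolver
open import Data.Nat.Base as ℕ using (zero; suc; _∸_; _<_; z≤n; s≤s; NonZero; _%_)
open import Data.Nat.Divisibility as ℕ∣ using (_∣?_; divides)
open import Data.Nat.DivMod using (%-distribˡ-*; [m+kn]%n≡m%n; m%n<n)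
open import Data.Nat.Primality using (euclidsLemma; prime[2])
import Data.Nat.Properties as ℕ
import Data.Nat.Solver as ℕSolver
open import Data.Product.Base using (_,_)
open import Data.Sum.Base using (inj₁; inj₂; [_,_]′)
open import Function.Base using (_∘_; id)
open import Function.Bundles using (mk⇔)
open import Level using (0ℓ)
open import Relation.Binary.PropositionalEquality
  using (_≡_; _≢_; _≗_; refl; sym; trans; cong; cong₂; subst; isEquivalence; module ≡-Reasoning)
open import Relation.Nullary.Decidable using (Dec; does; yes; no; does-⇔; dec-true; dec-false)
open import Relation.Nullary.Negation using (¬_; contradiction)
open import Algebra.Properties.Semiring.Sum ℤ.+-*-semiring
  using (sum; sum-cong-≗; sum-init-last; sum-replicate-zero; ∑-distrib-+; *-distribˡ-sum)

-- The commutative semiring of power series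

infixl 6 _⊕_
_⊕_ : Series → Series → Series
(a ⊕ b) m = a m ℤ.+ b m

𝟘 : Series
𝟘 _ = 0ℤ

-- Coefficient `m` of a product involves only coefficients up to `m`. The bounded form serves the
-- infinite products, whose partial products agree only up to a given degree.
⊛-cong-≤ : ∀ {a b c d} m → (∀ j → j ≤ m → a j ≡ b j) → (∀ j → j ≤ m → c j ≡ d j) →
           (a ⊛ c) m ≡ (b ⊛ d) m
⊛-cong-≤ m a≡b c≡d = sum-cong-≗ {suc m} λ i →
  cong₂ ℤ._*_ (a≡b _ (Fin.toℕ≤pred[n] i)) (c≡d _ (ℕ.m∸n≤m m (toℕ i)))

⊛-cong : ∀ {a b c d} → a ≗ b → c ≗ d → a ⊛ c ≗ b ⊛ d
⊛-cong a≗b c≗d m = ⊛-cong-≤ m (λ j _ → a≗b j) (λ j _ → c≗d j)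

⊛-distribʳ-⊕ : ∀ c a b → (a ⊕ b) ⊛ c ≗ a ⊛ c ⊕ b ⊛ c
⊛-distribʳ-⊕ c a b m = trans
  (sum-cong-≗ {suc m} λ i → ℤ.*-distribʳ-+ (c (m ∸ toℕ i)) (a (toℕ i)) (b (toℕ i)))
  (∑-distrib-+ {suc m} (λ i → a (toℕ i) ℤ.* c (m ∸ toℕ i)) (λ i → b (toℕ i) ℤ.* c (m ∸ toℕ i)))

⊛-zeroˡ : ∀ a → 𝟘 ⊛ a ≗ 𝟘
⊛-zeroˡ a m = sum-replicate-zero (suc m)

scale-⊛ : ∀ x a b m → ((λ j → x ℤ.* a j) ⊛ b) m ≡ x ℤ.* (a ⊛ b) m
scale-⊛ x a b m = trans
  (sum-cong-≗ {suc m} λ i → ℤ.*-assoc x (a (toℕ i)) (b (m ∸ toℕ i)))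
  (sym (*-distribˡ-sum {suc m} x λ i → a (toℕ i) ℤ.* b (m ∸ toℕ i)))

-- Induction on the degree: by definition the tail of `a ⊛ b` is `a 0` times the tail of `b`, plus
-- the tail of `a` times `b`; the induction hypothesis handles the latter.
⊛-assoc : ∀ a b c → (a ⊛ b) ⊛ c ≗ a ⊛ (b ⊛ c)
⊛-assoc a b c zero = solve 3 (λ x y z →
  (x :* y :+ con 0ℤ) :* z :+ con 0ℤ := x :* (y :* z :+ con 0ℤ) :+ con 0ℤ) refl (a 0) (b 0) (c 0)
  where open ℤSolver.+-*-Solver
⊛-assoc a b c (suc m) = begin
  (a 0 ℤ.* b 0 ℤ.+ 0ℤ) ℤ.* c (suc m) ℤ.+ ((scaled ⊕ tail-a ⊛ b) ⊛ c) m
    ≡⟨ cong₂ ℤ._+_ (refl {x = (a 0 ℤ.* b 0 ℤ.+ 0ℤ) ℤ.* c (suc m)}) (begin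
         ((scaled ⊕ tail-a ⊛ b) ⊛ c) m
           ≡⟨ ⊛-distribʳ-⊕ c scaled (tail-a ⊛ b) m ⟩
         (scaled ⊛ c) m ℤ.+ ((tail-a ⊛ b) ⊛ c) m
           ≡⟨ cong₂ ℤ._+_ (scale-⊛ (a 0) (b ∘ suc) c m) (⊛-assoc tail-a b c m) ⟩
         a 0 ℤ.* ((b ∘ suc) ⊛ c) m ℤ.+ (tail-a ⊛ (b ⊛ c)) m ∎) ⟩
  (a 0 ℤ.* b 0 ℤ.+ 0ℤ) ℤ.* c (suc m)
    ℤ.+ (a 0 ℤ.* ((b ∘ suc) ⊛ c) m ℤ.+ (tail-a ⊛ (b ⊛ c)) m)
    ≡⟨ solve 5 (λ x y z u v →
         (x :* y :+ con 0ℤ) :* z :+ (x :* u :+ v) := x :* (y :* z :+ u) :+ v)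
         refl (a 0) (b 0) (c (suc m)) _ _ ⟩
  a 0 ℤ.* (b ⊛ c) (suc m) ℤ.+ (tail-a ⊛ (b ⊛ c)) m ∎
  where
  open ≡-Reasoning
  open ℤSolver.+-*-Solver
  tail-a scaled : Series
  tail-a = a ∘ suc
  scaled j = a 0 ℤ.* b (suc j)

-- The convolution unfolds at its first term by definition; peeling off the last term gives the
-- mirrored recursion that commutativity needs.
⊛-suc-last : ∀ a b m → (a ⊛ b) (suc m) ≡ (a ⊛ (b ∘ suc)) m ℤ.+ a (suc m) ℤ.* b 0
⊛-suc-last a b zero = solve 2 (λ x y → x :+ (y :+ con 0ℤ) := x :+ con 0ℤ :+ y)
  refl (a 0 ℤ.* b 1) (a 1 ℤ.* b 0)
  where open ℤSolver.+-*-Solver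
⊛-suc-last a b (suc m) = trans
  (cong₂ ℤ._+_ (refl {x = a 0 ℤ.* b (suc (suc m))}) (⊛-suc-last (a ∘ suc) b m))
  (sym (ℤ.+-assoc (a 0 ℤ.* b (suc (suc m))) _ _))

⊛-comm : ∀ a b → a ⊛ b ≗ b ⊛ a
⊛-comm a b zero    = cong (ℤ._+ 0ℤ) (ℤ.*-comm (a 0) (b 0))
⊛-comm a b (suc m) = begin
  a 0 ℤ.* b (suc m) ℤ.+ ((a ∘ suc) ⊛ b) m
    ≡⟨ cong₂ ℤ._+_ (ℤ.*-comm (a 0) (b (suc m))) (⊛-comm (a ∘ suc) b m) ⟩
  b (suc m) ℤ.* a 0 ℤ.+ (b ⊛ (a ∘ suc)) m
    ≡⟨ ℤ.+-comm (b (suc m) ℤ.* a 0) _ ⟩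
  (b ⊛ (a ∘ suc)) m ℤ.+ b (suc m) ℤ.* a 0
    ≡⟨ ⊛-suc-last b a m ⟨
  (b ⊛ a) (suc m) ∎
  where open ≡-Reasoning

⊛-isCommutativeMonoid : IsCommutativeMonoid _≗_ _⊛_ 𝟙
⊛-isCommutativeMonoid = record
  { isMonoid = record
    { isSemigroup = record
      { isMagma = record
        { isEquivalence = Pointwise.isEquivalence ℕ isEquivalence
        ; ∙-cong = ⊛-cong }
      ; assoc = ⊛-assoc }
    ; identity = (λ a m → trans (⊛-comm 𝟙 a m) (⊛-identityʳ a m)) , ⊛-identityʳ }
  ; comm = ⊛-comm }

series-commutativeSemiring : CommutativeSemiring 0ℓ 0ℓ
series-commutativeSemiring = record
  { isCommutativeSemiring = isCommutativeSemiringˡ record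
    { +-isCommutativeMonoid = Pointwise.isCommutativeMonoid ℕ ℤ.+-0-isCommutativeMonoid
    ; *-isCommutativeMonoid = ⊛-isCommutativeMonoid
    ; distribʳ = ⊛-distribʳ-⊕
    ; zeroˡ = ⊛-zeroˡ } }

module 𝕊 = CommutativeSemiring series-commutativeSemiring
module Pow = Power 𝕊.*-commutativeMonoid
module Mul = Multiple 𝕊.+-monoid
import Relation.Binary.Reasoning.Setoid 𝕊.setoid as ≗-Reasoning

-- Together with `⊖-⊕` this removes subtraction, which the semiring solver cannot express:
-- subtracted terms are added to both sides.
⊕-cancelʳ : ∀ {a b} c → a ⊕ c ≗ b ⊕ c → a ≗ b
⊕-cancelʳ c eq m = +-cancelʳ (c m) _ _ (eq m)
  where open RingProperties ℤ.+-*-ring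

⊖-⊕ : ∀ a b → (a ⊖ b) ⊕ b ≗ a
⊖-⊕ a b m = solve 2 (λ x y → x :- y :+ y := x) refl (a m) (b m)
  where open ℤSolver.+-*-Solver

recip-cancel : ∀ {a b x} → b 0 ≡ 1ℤ → a ≗ b ⊛ x → a ⊛ recip b ≗ x
recip-cancel {a} {b} {x} b₀ a≗bx = begin
  a ⊛ recip b         ≈⟨ 𝕊.*-congʳ {recip b} a≗bx ⟩
  (b ⊛ x) ⊛ recip b   ≈⟨ solve 3 (λ b x r → (b :* x) :* r := x :* (b :* r)) 𝕊.refl b x (recip b) ⟩
  x ⊛ (b ⊛ recip b)   ≈⟨ 𝕊.*-congˡ {x} (⊛-recip b b₀) ⟩
  x ⊛ 𝟙               ≈⟨ ⊛-identityʳ x ⟩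
  x                   ∎
  where
  open ≗-Reasoning
  open Solver series-commutativeSemiring

-- Monomials and geometric series

q^-≡ : ∀ {j m} → m ≡ j → (q^ j) m ≡ 1ℤ
q^-≡ {zero}  refl = refl
q^-≡ {suc j} refl = q^-≡ {j} refl

q^-≢ : ∀ {j m} → m ≢ j → (q^ j) m ≡ 0ℤ
q^-≢ {zero}  {zero}  m≢j = contradiction refl m≢j
q^-≢ {zero}  {suc m} m≢j = refl
q^-≢ {suc j} {zero}  m≢j = refl
q^-≢ {suc j} {suc m} m≢j = q^-≢ {j} {m} (m≢j ∘ cong suc)

q^-⊛-< : ∀ {j m} a → m < j → (q^ j ⊛ a) m ≡ 0ℤ
q^-⊛-< {suc j} {zero}  a _         = refl
q^-⊛-< {suc j} {suc m} a (s≤s m<j) = trans (ℤ.+-identityˡ _) (q^-⊛-< {j} {m} a m<j)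

q^-⊛-+ : ∀ j a r → (q^ j ⊛ a) (j + r) ≡ a r
q^-⊛-+ zero    a r = 𝕊.*-identityˡ a r
q^-⊛-+ (suc j) a r = trans (ℤ.+-identityˡ _) (q^-⊛-+ j a r)

q^-homo-+ : ∀ i j → q^ (i + j) ≗ q^ i ⊛ q^ j
q^-homo-+ zero    j m       = sym (𝕊.*-identityˡ (q^ j) m)
q^-homo-+ (suc i) j zero    = refl
q^-homo-+ (suc i) j (suc m) = trans (q^-homo-+ i j m) (sym (ℤ.+-identityˡ _))

-- 1 / (1 - q^k), for k > 0
geometric : ℕ → Series
geometric k m = if does (k ∣? m) then 1ℤ else 0ℤ

geometric-∣ : ∀ {k m} → k ℕ∣.∣ m → geometric k m ≡ 1ℤ
geometric-∣ {k} {m} k∣m rewrite dec-true (k ∣? m) k∣m = refl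

geometric-∤ : ∀ {k m} → ¬ k ℕ∣.∣ m → geometric k m ≡ 0ℤ
geometric-∤ {k} {m} k∤m rewrite dec-false (k ∣? m) k∤m = refl

geometric-+ : ∀ k r → geometric k (k + r) ≡ geometric k r
geometric-+ k r = cong (if_then 1ℤ else 0ℤ) (does-⇔
  (mk⇔ (λ k∣k+r → ℕ∣.∣m+n∣m⇒∣n k∣k+r ℕ∣.∣-refl) (ℕ∣.∣m∣n⇒∣m+n ℕ∣.∣-refl))
  (k ∣? (k + r)) (k ∣? r))

-- Multiplication by `q^ k` shifts by `k`, which preserves the multiples of `k`; below `k` the only
-- multiple is 0.
geometric-unfold : ∀ k .{{_ : NonZero k}} → geometric k ≗ 𝟙 ⊕ q^ k ⊛ geometric k
geometric-unfold k@(suc _) zero = refl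
geometric-unfold k@(suc _) (suc m) with ℕ.≤-<-connex k (suc m)
... | inj₁ k≤1+m with r , refl ← ℕ.m≤n⇒∃[o]m+o≡n k≤1+m = begin
  geometric k (k + r)              ≡⟨ geometric-+ k r ⟩
  geometric k r                    ≡⟨ q^-⊛-+ k (geometric k) r ⟨
  (q^ k ⊛ geometric k) (k + r)     ≡⟨ ℤ.+-identityˡ _ ⟨
  (𝟙 ⊕ q^ k ⊛ geometric k) (k + r) ∎
  where open ≡-Reasoning
... | inj₂ 1+m<k = begin
  geometric k (suc m)                   ≡⟨ geometric-∤ (ℕ∣.>⇒∤ 1+m<k) ⟩
  0ℤ                                    ≡⟨ q^-⊛-< (geometric k) 1+m<k ⟨
  (q^ k ⊛ geometric k) (suc m)          ≡⟨ ℤ.+-identityˡ _ ⟨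
  0ℤ ℤ.+ (q^ k ⊛ geometric k) (suc m)   ∎
  where open ≡-Reasoning

lambert : ℕ → Series
lambert k = q^ k ⊛ geometric k

-- (1 - q^2k) / (1 - q^k)²
factor : ℕ → Series
factor k = 𝟙 ⊕ (lambert k ⊕ lambert k)

-- With `q` for `q^ k`, `d = 1 - q` and `g = 1 / d`: `d² (1 + 2 q g) = d² + 2 d q = (d + q)² - q² =
-- 1 - q²`. The proof adds `q²` to both sides.
factor-spec : ∀ k .{{_ : NonZero k}} →
              𝟙 ⊖ q^ (k + k) ≗ ((𝟙 ⊖ q^ k) ⊛ (𝟙 ⊖ q^ k)) ⊛ factor k
factor-spec k = ⊕-cancelʳ (q ⊛ q) (begin
  (𝟙 ⊖ q^ (k + k)) ⊕ q ⊛ q          ≈⟨ 𝕊.+-congˡ {𝟙 ⊖ q^ (k + k)} (q^-homo-+ k k) ⟨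
  (𝟙 ⊖ q^ (k + k)) ⊕ q^ (k + k)     ≈⟨ ⊖-⊕ 𝟙 (q^ (k + k)) ⟩
  𝟙                                 ≈⟨ ⊖-⊕ 𝟙 q ⟨
  d ⊕ q                             ≈⟨ 𝕊.+-congˡ {d} (𝕊.*-identityˡ q) ⟨
  d ⊕ 𝟙 ⊛ q                         ≈⟨ 𝕊.+-congˡ {d} (𝕊.*-congʳ {q} (⊖-⊕ 𝟙 q)) ⟨
  d ⊕ (d ⊕ q) ⊛ q
    ≈⟨ solve 2 (λ d q → d :+ (d :+ q) :* q := d :* con 1 :+ d :* q :+ q :* q) 𝕊.refl d q ⟩
  d ⊛ 𝟙 ⊕ d ⊛ q ⊕ q ⊛ q
    ≈⟨ 𝕊.+-congʳ {q ⊛ q} (𝕊.+-congʳ {d ⊛ q} (𝕊.*-congˡ {d} (⊖-⊕ 𝟙 q))) ⟨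
  d ⊛ (d ⊕ q) ⊕ d ⊛ q ⊕ q ⊛ q
    ≈⟨ solve 2 (λ d q → d :* (d :+ q) :+ d :* q :+ q :* q
                      := d :* (d :+ (con 1 :+ con 1) :* q :* con 1) :+ q :* q) 𝕊.refl d q ⟩
  d ⊛ (d ⊕ (𝟙 ⊕ 𝟙) ⊛ q ⊛ 𝟙) ⊕ q ⊛ q
    -- Writing the last `𝟙` as `d ⊛ g` supplies the second factor `d`.
    ≈⟨ 𝕊.+-congʳ {q ⊛ q} (𝕊.*-congˡ {d} (𝕊.+-congˡ {d} (𝕊.*-congˡ {(𝟙 ⊕ 𝟙) ⊛ q} dg≗1))) ⟨
  d ⊛ (d ⊕ (𝟙 ⊕ 𝟙) ⊛ q ⊛ (d ⊛ g)) ⊕ q ⊛ q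
    ≈⟨ solve 3 (λ d q g → d :* (d :+ (con 1 :+ con 1) :* q :* (d :* g)) :+ q :* q
                        := (d :* d) :* (con 1 :+ (q :* g :+ q :* g)) :+ q :* q) 𝕊.refl d q g ⟩
  (d ⊛ d) ⊛ factor k ⊕ q ⊛ q ∎)
  where
  open ≗-Reasoning
  open Solver series-commutativeSemiring
  q = q^ k
  g = geometric k
  d = 𝟙 ⊖ q

  dg≗1 : d ⊛ g ≗ 𝟙
  dg≗1 = ⊕-cancelʳ (q ⊛ g) (begin
    d ⊛ g ⊕ q ⊛ g ≈⟨ ⊛-distribʳ-⊕ g d q ⟨
    (d ⊕ q) ⊛ g   ≈⟨ 𝕊.*-congʳ {g} (⊖-⊕ 𝟙 q) ⟩
    𝟙 ⊛ g         ≈⟨ 𝕊.*-identityˡ g ⟩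
    g             ≈⟨ geometric-unfold k ⟩
    𝟙 ⊕ q ⊛ g     ∎)

-- Infinite products

Stable : (ℕ → Series) → Set
Stable g = ∀ n j → j < n → g n j ≡ 𝟙 j

Stable-⊛ : ∀ {g h} → Stable g → Stable h → Stable (λ n → g n ⊛ h n)
Stable-⊛ g≡1 h≡1 n j j<n = trans
  (⊛-cong-≤ j (λ i i≤j → g≡1 n i (ℕ.≤-<-trans i≤j j<n)) (λ i i≤j → h≡1 n i (ℕ.≤-<-trans i≤j j<n)))
  (⊛-identityʳ 𝟙 j)

-- Products start at index 1, so agreement is asked of successors; this lets `factor-spec` apply,
-- whose exponent must be nonzero.
∏≤-cong : ∀ {g h} → (∀ n → g (suc n) ≗ h (suc n)) → ∀ N → ∏≤ N g ≗ ∏≤ N h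
∏≤-cong g≗h zero    = 𝕊.refl
∏≤-cong g≗h (suc N) = ⊛-cong (∏≤-cong g≗h N) (g≗h N)

∏≤-⊛ : ∀ g h N → ∏≤ N (λ n → g n ⊛ h n) ≗ ∏≤ N g ⊛ ∏≤ N h
∏≤-⊛ g h zero    = 𝕊.sym (⊛-identityʳ 𝟙)
∏≤-⊛ g h (suc N) = 𝕊.trans (𝕊.*-congʳ {g (suc N) ⊛ h (suc N)} (∏≤-⊛ g h N))
  (solve 4 (λ a b c d → (a :* b) :* (c :* d) := (a :* c) :* (b :* d)) 𝕊.refl
    (∏≤ N g) (∏≤ N h) (g (suc N)) (h (suc N)))
  where open Solver series-commutativeSemiring

-- Coefficient `m` on the left uses partial products of length `m`; on the right, coefficient `j`
-- comes from length `j`. Stability makes these lengths interchangeable for `j ≤ m`.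
∏∞-⊛ : ∀ g h → Stable g → Stable h → ∏∞ (λ n → g n ⊛ h n) ≗ ∏∞ g ⊛ ∏∞ h
∏∞-⊛ g h g≡1 h≡1 m = trans (∏≤-⊛ g h m m)
  (⊛-cong-≤ m (λ j j≤m → ∏≤-stable g g≡1 j≤m) (λ j j≤m → ∏≤-stable h h≡1 j≤m))

Stable-1-q^ : ∀ k .{{_ : NonZero k}} → Stable (λ n → 𝟙 ⊖ q^ (k * n))
Stable-1-q^ k n j j<n =
  trans (cong (λ x → 𝟙 j ℤ.- x) (q^-≢ (ℕ.<⇒≢ (ℕ.<-≤-trans j<n (ℕ.m≤n*m n k))))) (ℤ.+-identityʳ (𝟙 j))

Stable-factor : ∀ k .{{_ : NonZero k}} → Stable (λ n → factor (k * n))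
Stable-factor k n j j<n
  rewrite q^-⊛-< (geometric (k * n)) (ℕ.<-≤-trans j<n (ℕ.m≤n*m n k)) = ℤ.+-identityʳ (𝟙 j)

-- The quotients `f (2 * k) / (f k)²` and the generating function

P : ℕ → Series
P k = ∏∞ (λ n → factor (k * n))

f-double : ∀ k .{{_ : NonZero k}} → f (2 * k) ≗ (f k ⊛ f k) ⊛ P k
f-double k = begin
  f (2 * k)
    ≈⟨ (λ m → ∏≤-cong factorize m m) ⟩
  ∏∞ (λ n → ((𝟙 ⊖ q^ (k * n)) ⊛ (𝟙 ⊖ q^ (k * n))) ⊛ factor (k * n))
    ≈⟨ ∏∞-⊛ _ _ (Stable-⊛ (Stable-1-q^ k) (Stable-1-q^ k)) (Stable-factor k) ⟩
  ∏∞ (λ n → (𝟙 ⊖ q^ (k * n)) ⊛ (𝟙 ⊖ q^ (k * n))) ⊛ P k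
    ≈⟨ 𝕊.*-congʳ {P k} (∏∞-⊛ _ _ (Stable-1-q^ k) (Stable-1-q^ k)) ⟩
  (f k ⊛ f k) ⊛ P k ∎
  where
  open ≗-Reasoning
  factorize : ∀ n → 𝟙 ⊖ q^ (2 * k * suc n) ≗
              ((𝟙 ⊖ q^ (k * suc n)) ⊛ (𝟙 ⊖ q^ (k * suc n))) ⊛ factor (k * suc n)
  factorize n
    rewrite trans (ℕ.*-assoc 2 k (suc n)) (cong (_+_ (k * suc n)) (ℕ.+-identityʳ (k * suc n))) =
    factor-spec (k * suc n) {{ℕ.m*n≢0 k (suc n)}}

-- For `c = 2 + d` the exponents are `1 + d` on `f 4` and `1 + 2 d` on `f 2`. Since
-- `f 4 = (f 2)² P 2`, the numerator has `2 + 2 d` factors `f 2`; all but one cancel, and the last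
-- one is `(f 1)² P 1`.
overcubicGF≗ : ∀ d → overcubicGF (2 + d) ≗ P 1 ⊛ P 2 ^ˢ suc d
overcubicGF≗ d = recip-cancel {b = f 1 ^ˢ 2 ⊛ f 2 ^ᶻ (+ (2 * (2 + d)) ℤ.- + 3)}
  (denominator-const (+ (2 * (2 + d)) ℤ.- + 3)) numerator
  where
  open ≗-Reasoning
  open Solver series-commutativeSemiring

  exponent : + (2 * (2 + d)) ℤ.- + 3 ≡ + (d + suc d)
  exponent = cong (λ n → + n ℤ.- + 3) {2 * (2 + d)} {3 + (d + suc d)}
    (ℕS.solve 1 (λ d → ℕS.con 2 ℕS.:* (ℕS.con 2 ℕS.:+ d)
                       ℕS.:= ℕS.con 3 ℕS.:+ (d ℕS.:+ (ℕS.con 1 ℕS.:+ d))) refl d)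
    where module ℕS = ℕSolver.+-*-Solver

  numerator : f 4 ^ˢ suc d ≗
    (f 1 ^ˢ 2 ⊛ f 2 ^ᶻ (+ (2 * (2 + d)) ℤ.- + 3)) ⊛ (P 1 ⊛ P 2 ^ˢ suc d)
  numerator = begin
    f 4 ^ˢ suc d
      ≈⟨ Pow.×-congʳ (suc d) (f-double 2) ⟩
    ((f 2 ⊛ f 2) ⊛ P 2) ^ˢ suc d
      ≈⟨ Pow.×-distrib-+ (f 2 ⊛ f 2) (P 2) (suc d) ⟩
    (f 2 ⊛ f 2) ^ˢ suc d ⊛ P 2 ^ˢ suc d
      ≈⟨ 𝕊.*-congʳ {P 2 ^ˢ suc d} (Pow.×-distrib-+ (f 2) (f 2) (suc d)) ⟩
    ((f 2 ⊛ f 2 ^ˢ d) ⊛ f 2 ^ˢ suc d) ⊛ P 2 ^ˢ suc d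
      ≈⟨ solve 4 (λ a b c p → ((a :* b) :* c) :* p := a :* (b :* c) :* p) 𝕊.refl
           (f 2) (f 2 ^ˢ d) (f 2 ^ˢ suc d) (P 2 ^ˢ suc d) ⟩
    (f 2 ⊛ (f 2 ^ˢ d ⊛ f 2 ^ˢ suc d)) ⊛ P 2 ^ˢ suc d
      ≈⟨ 𝕊.*-congʳ {P 2 ^ˢ suc d} (⊛-cong (f-double 1) (𝕊.sym (Pow.×-homo-+ (f 2) d (suc d)))) ⟩
    (((f 1 ⊛ f 1) ⊛ P 1) ⊛ f 2 ^ˢ (d + suc d)) ⊛ P 2 ^ˢ suc d
      ≈⟨ solve 4 (λ a p b r → (((a :* a) :* p) :* b) :* r := ((a :* (a :* con 1)) :* b) :* (p :* r))
           𝕊.refl (f 1) (P 1) (f 2 ^ˢ (d + suc d)) (P 2 ^ˢ suc d) ⟩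
    (f 1 ^ˢ 2 ⊛ f 2 ^ˢ (d + suc d)) ⊛ (P 1 ⊛ P 2 ^ˢ suc d)
      ≡⟨ cong (λ z → (f 1 ^ˢ 2 ⊛ f 2 ^ᶻ z) ⊛ (P 1 ⊛ P 2 ^ˢ suc d)) exponent ⟨
    (f 1 ^ˢ 2 ⊛ f 2 ^ᶻ (+ (2 * (2 + d)) ℤ.- + 3)) ⊛ (P 1 ⊛ P 2 ^ˢ suc d) ∎

-- Series congruent to 1 + 2x modulo 4

infix 4 _≡1+2_
-- The quotient `e` is kept as data and multiples are written as sums, so that products of
-- expansions become semiring identities for the solver.
record _≡1+2_ (a x : Series) : Set where
  constructor _,_
  field
    e         : Series
    expansion : a ≗ 𝟙 ⊕ (x ⊕ x) ⊕ ((e ⊕ e) ⊕ (e ⊕ e))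

≡1+2-exact : ∀ x → 𝟙 ⊕ (x ⊕ x) ≡1+2 x
≡1+2-exact x = 𝟘 , λ m → sym (ℤ.+-identityʳ _)

≡1+2-respʳ : ∀ {a x y} → x ≗ y → a ≡1+2 x → a ≡1+2 y
≡1+2-respʳ {y = y} x≗y (e , a≗) =
  e , 𝕊.trans a≗ (𝕊.+-congʳ {(e ⊕ e) ⊕ (e ⊕ e)} (𝕊.+-congˡ {𝟙} (𝕊.+-cong x≗y x≗y)))

≡1+2-𝟙 : 𝟙 ≡1+2 𝟘
≡1+2-𝟙 = 𝟘 , λ m → sym (trans (ℤ.+-identityʳ _) (ℤ.+-identityʳ _))

-- The cross term of `(1 + 2x)(1 + 2y)` is `4xy`, so modulo 4 multiplication adds the linear parts.
≡1+2-⊛ : ∀ {a b x y} → a ≡1+2 x → b ≡1+2 y → a ⊛ b ≡1+2 x ⊕ y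
≡1+2-⊛ {x = x} {y} (e , a≗) (e′ , b≗) =
  -- One quarter of all terms of the product beyond `1 + 2 (x + y)`.
  x ⊛ y ⊕ e ⊕ e′ ⊕ (x ⊛ e′ ⊕ x ⊛ e′) ⊕ (e ⊛ y ⊕ e ⊛ y) ⊕ (e ⊛ e′ ⊕ e ⊛ e′ ⊕ (e ⊛ e′ ⊕ e ⊛ e′)) ,
  𝕊.trans (⊛-cong a≗ b≗) (solve 4 (λ x y e e′ →
    let one+ x e = con 1 :+ (x :+ x) :+ ((e :+ e) :+ (e :+ e)) in
    one+ x e :* one+ y e′ :=
    one+ (x :+ y) (x :* y :+ e :+ e′ :+ (x :* e′ :+ x :* e′) :+ (e :* y :+ e :* y)
                   :+ (e :* e′ :+ e :* e′ :+ (e :* e′ :+ e :* e′))))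
    𝕊.refl x y e e′)
  where open Solver series-commutativeSemiring

≡1+2-^ : ∀ {a x} n → a ≡1+2 x → a ^ˢ n ≡1+2 n Mul.× x
≡1+2-^ zero    a≡ = ≡1+2-𝟙
≡1+2-^ (suc n) a≡ = ≡1+2-⊛ a≡ (≡1+2-^ n a≡)

-- Expansion of `P k` modulo 4

∑≤ : ℕ → (ℕ → Series) → Series
∑≤ N l m = sum {N} (λ i → l (suc (toℕ i)) m)

∑≤-suc : ∀ N l → ∑≤ (suc N) l ≗ ∑≤ N l ⊕ l (suc N)
∑≤-suc N l m = trans (sum-init-last {N} (λ i → l (suc (toℕ i)) m))
  (cong₂ ℤ._+_ (sum-cong-≗ {N} (λ i → cong (λ n → l (suc n) m) (Fin.toℕ-inject₁ i)))
               (cong (λ n → l (suc n) m) (Fin.toℕ-fromℕ N)))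

∏≤-≡1+2 : ∀ {g l} → (∀ n → g n ≡1+2 l n) → ∀ N → ∏≤ N g ≡1+2 ∑≤ N l
∏≤-≡1+2         g≡ zero    = ≡1+2-𝟙
∏≤-≡1+2 {l = l} g≡ (suc N) =
  ≡1+2-respʳ (𝕊.sym (∑≤-suc N l)) (≡1+2-⊛ (∏≤-≡1+2 g≡ N) (g≡ (suc N)))

-- At `m > 0` this counts the pairs of positive integers (a , b) with k a b = m; the cutoff `m`
-- follows the one in `∏∞`.
divisorSeries : ℕ → Series
divisorSeries k m = ∑≤ m (λ n → lambert (k * n)) m

P-≡1+2 : ∀ k → P k ≡1+2 divisorSeries k
-- Coefficient `m` of `P k` comes from the product of `m` factors, so the error term is likewise
-- read off the expansion of length `m`.
P-≡1+2 k = (λ m → e (expand m) m) , λ m → expansion (expand m) m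
  where
  open _≡1+2_
  expand : ∀ m → ∏≤ m (λ n → factor (k * n)) ≡1+2 ∑≤ m (λ n → lambert (k * n))
  expand = ∏≤-≡1+2 (λ n → ≡1+2-exact (lambert (k * n)))

-- At a positive index the constant 1 contributes nothing, leaving `2 (x N) + 4 (e N)`.
4∣≡1+2 : ∀ {a x} N .{{_ : NonZero N}} → a ≡1+2 x → + 2 Signed.∣ x N → + 4 ∣ a N
4∣≡1+2 {a} {x} N@(suc _) (e , a≗) (Signed.divides h xN≡h*2) =
  Signed.∣⇒∣ᵤ (Signed.divides (h ℤ.+ e N) (begin
  a N
    ≡⟨ a≗ N ⟩
  0ℤ ℤ.+ (x N ℤ.+ x N) ℤ.+ ((e N ℤ.+ e N) ℤ.+ (e N ℤ.+ e N))
    ≡⟨ cong (λ z → 0ℤ ℤ.+ (z ℤ.+ z) ℤ.+ ((e N ℤ.+ e N) ℤ.+ (e N ℤ.+ e N))) xN≡h*2 ⟩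
  0ℤ ℤ.+ (h ℤ.* + 2 ℤ.+ h ℤ.* + 2) ℤ.+ ((e N ℤ.+ e N) ℤ.+ (e N ℤ.+ e N))
    ≡⟨ solve 2 (λ h e → con 0ℤ :+ (h :* con (+ 2) :+ h :* con (+ 2)) :+ ((e :+ e) :+ (e :+ e))
                      := (h :+ e) :* con (+ 4)) refl h (e N) ⟩
  (h ℤ.+ e N) ℤ.* + 4 ∎))
  where
  open ≡-Reasoning
  open ℤSolver.+-*-Solver

∣-× : ∀ {z} n (x : Series) m → z Signed.∣ x m → z Signed.∣ (n Mul.× x) m
∣-× zero    x m z∣ = Signed.divides 0ℤ refl
∣-× (suc n) x m z∣ = Signed.∣m∣n⇒∣m+n z∣ (∣-× n x m z∣)

-- Parity of the number of factorizations

sum-q^ : ∀ {n} j → j < n → sum {n} (λ i → (q^ j) (toℕ i)) ≡ 1ℤ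
sum-q^ {suc n} zero    _         = cong (ℤ._+_ 1ℤ) (sum-replicate-zero n)
sum-q^ {suc n} (suc j) (s≤s j<n) = trans (ℤ.+-identityˡ _) (sum-q^ {n} j j<n)

-- Replaces the divisibility test by a sum over possible cofactors from 1 to `N`, at most one of
-- which contributes. This turns `divisorSeries` into a double sum over a square.
lambert-sum : ∀ c N .{{_ : NonZero N}} → lambert c N ≡ sum {N} (λ j → (q^ (c * suc (toℕ j))) N)
lambert-sum zero N@(suc n) = trans (𝕊.*-identityˡ (geometric 0) N)
  (trans (geometric-∤ (ℕ.1+n≢0 {n} ∘ ℕ∣.0∣⇒≡0)) (sym (sum-replicate-zero N)))
lambert-sum c@(suc _) N@(suc _) = trans lambert≡geometric (geometric-sum (c ∣? N))
  where
  lambert≡geometric : lambert c N ≡ geometric c N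
  lambert≡geometric = sym (trans (geometric-unfold c N) (ℤ.+-identityˡ _))

  geometric-sum : Dec (c ℕ∣.∣ N) → geometric c N ≡ sum {N} (λ j → (q^ (c * suc (toℕ j))) N)
  geometric-sum (no c∤N) = trans (geometric-∤ c∤N) (sym (trans
    (sum-cong-≗ {N} (λ j → q^-≢ {c * suc (toℕ j)} (λ N≡ →
      c∤N (divides (suc (toℕ j)) (trans N≡ (ℕ.*-comm c (suc (toℕ j))))))))
    (sum-replicate-zero N)))
  geometric-sum (yes c∣N@(divides (suc b) N≡)) =
    trans (geometric-∣ c∣N) (sym (trans (sum-cong-≗ {N} (shift ∘ toℕ)) (sum-q^ b b<N)))
    where
    b<N : b < N
    b<N = subst (b <_) (sym N≡) (ℕ.m≤m*n (suc b) c)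

    -- Summand `j` stands for the cofactor `suc j`, so the quotient `suc b` is hit exactly at
    -- `j = b`.
    shift : ∀ j → (q^ (c * suc j)) N ≡ (q^ b) j
    shift j with j ℕ.≟ b
    ... | yes refl = trans (q^-≡ (trans N≡ (ℕ.*-comm (suc b) c))) (sym (q^-≡ {b} refl))
    ... | no j≢b   = trans (q^-≢ (λ N≡′ → j≢b (ℕ.suc-injective (ℕ.*-cancelˡ-≡ (suc j) (suc b) c
                       (trans (sym N≡′) (trans N≡ (ℕ.*-comm (suc b) c))))))) (sym (q^-≢ {b} j≢b))

-- Off the diagonal, `t i j` and `t j i` pair up. The induction strips the first row and the first
-- column, whose sums coincide.
sum-symmetric-even : ∀ n (t : Fin n → Fin n → ℤ) → (∀ i j → t i j ≡ t j i) → (∀ i → t i i ≡ 0ℤ) →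
                     + 2 Signed.∣ sum {n} (λ i → sum {n} (t i))
sum-symmetric-even zero    t t-sym t-diag = Signed.divides 0ℤ refl
sum-symmetric-even (suc n) t t-sym t-diag = subst (+ 2 Signed.∣_) (sym split)
  (Signed.∣m∣n⇒∣m+n (Signed.divides row refl)
    (sum-symmetric-even n (λ i j → t (Fin.suc i) (Fin.suc j))
      (λ i j → t-sym (Fin.suc i) (Fin.suc j)) (λ i → t-diag (Fin.suc i))))
  where
  open ≡-Reasoning
  open ℤSolver.+-*-Solver
  row rest : ℤ
  row  = sum {n} (λ j → t Fin.zero (Fin.suc j))
  rest = sum {n} (λ i → sum {n} (λ j → t (Fin.suc i) (Fin.suc j)))

  split : sum {suc n} (λ i → sum {suc n} (t i)) ≡ row ℤ.* + 2 ℤ.+ rest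
  split = begin
    t Fin.zero Fin.zero ℤ.+ row ℤ.+ sum {n} (λ i → sum {suc n} (t (Fin.suc i)))
      ≡⟨ cong₂ (λ x y → x ℤ.+ row ℤ.+ y) (t-diag Fin.zero)
           (∑-distrib-+ {n} (λ i → t (Fin.suc i) Fin.zero) _) ⟩
    0ℤ ℤ.+ row ℤ.+ (sum {n} (λ i → t (Fin.suc i) Fin.zero) ℤ.+ rest)
      ≡⟨ cong (λ x → 0ℤ ℤ.+ row ℤ.+ (x ℤ.+ rest))
           (sum-cong-≗ {n} (λ i → t-sym (Fin.suc i) Fin.zero)) ⟩
    0ℤ ℤ.+ row ℤ.+ (row ℤ.+ rest)
      ≡⟨ solve 2 (λ x y → con 0ℤ :+ x :+ (x :+ y) := x :* con (+ 2) :+ y) refl row rest ⟩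
    row ℤ.* + 2 ℤ.+ rest ∎

divisorSeries-even : ∀ k N .{{_ : NonZero N}} → (∀ a → N ≢ k * a * a) →
                     + 2 Signed.∣ divisorSeries k N
divisorSeries-even k N N≢kaa = subst (+ 2 Signed.∣_)
  (sum-cong-≗ {N} (λ i → sym (lambert-sum (k * suc (toℕ i)) N)))
  (sum-symmetric-even N (λ i j → (q^ (k * suc (toℕ i) * suc (toℕ j))) N)
    (λ i j → cong (λ e → (q^ e) N) (swap k (suc (toℕ i)) (suc (toℕ j))))
    -- A nonzero diagonal entry would be a factorization `N = k * a * a`.
    (λ i → q^-≢ (N≢kaa (suc (toℕ i)))))
  where
  open ℕSolver.+-*-Solver
  swap : ∀ k a b → k * a * b ≡ k * b * a
  swap = solve 3 (λ k a b → k :* a :* b := k :* b :* a) refl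

-- Modulo 4 the generating function is `1 + 2 (D 1 + (1 + d) D 2)` with `D = divisorSeries`, and
-- `D 1` and `D 2` are both even at `N`.
4∣ā : ∀ d N .{{_ : NonZero N}} → (∀ a → N ≢ 1 * a * a) → (∀ a → N ≢ 2 * a * a) → + 4 ∣ ā (2 + d) N
4∣ā d N N≢a² N≢2a² = subst (+ 4 ∣_) (sym (overcubicGF≗ d N))
  (4∣≡1+2 N (≡1+2-⊛ (P-≡1+2 1) (≡1+2-^ (suc d) (P-≡1+2 2)))
    (Signed.∣m∣n⇒∣m+n (divisorSeries-even 1 N N≢a²)
      (∣-× (suc d) (divisorSeries 2) N (divisorSeries-even 2 N N≢2a²))))

-- 2^α (4n + 3) is neither a square nor twice a square

-- Squares are 0 or 1 modulo 4.
4n+3≢a² : ∀ n a → 4 * n + 3 ≢ a * a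
4n+3≢a² n a eq = residue (a % 4) (m%n<n a 4) (begin
  3                        ≡⟨ [m+kn]%n≡m%n 3 n 4 ⟨
  (3 + n * 4) % 4          ≡⟨ cong (_% 4) (trans (ℕ.+-comm 3 (n * 4)) (cong (_+ 3) (ℕ.*-comm n 4))) ⟩
  (4 * n + 3) % 4          ≡⟨ cong (_% 4) eq ⟩
  (a * a) % 4              ≡⟨ %-distribˡ-* a a 4 ⟩
  ((a % 4) * (a % 4)) % 4  ∎)
  where
  open ≡-Reasoning
  residue : ∀ r → r < 4 → 3 ≢ (r * r) % 4
  residue 0 _ ()
  residue 1 _ ()
  residue 2 _ ()
  residue 3 _ ()
  residue (suc (suc (suc (suc _)))) (s≤s (s≤s (s≤s (s≤s ()))))

4n+3≢2m : ∀ n m → 4 * n + 3 ≢ 2 * m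
4n+3≢2m n m eq = ℕ.even≢odd m (2 * n + 1) (trans (sym eq)
  (solve 1 (λ n → con 4 :* n :+ con 3 := con 1 :+ con 2 :* (con 2 :* n :+ con 1)) refl n))
  where open ℕSolver.+-*-Solver

-- Simultaneous descent on `α`: if 2m is a square then m is twice a square, and if 2m is twice a
-- square then m is a square. The base cases rest on residues modulo 4 and on parity.
2^α[4n+3]≢a² : ∀ n α a → 2 ^ α * (4 * n + 3) ≢ a * a
2^α[4n+3]≢2a² : ∀ n α a → 2 ^ α * (4 * n + 3) ≢ 2 * (a * a)

2^α[4n+3]≢a² n zero    a eq = 4n+3≢a² n a (trans (sym (ℕ.*-identityˡ _)) eq)
2^α[4n+3]≢a² n (suc α) a eq 
  with [ id , id ]′ (euclidsLemma a a prime[2] (subst (2 ℕ∣.∣_)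
         (trans (sym (ℕ.*-assoc 2 (2 ^ α) (4 * n + 3))) eq)
         (ℕ∣.m∣m*n (2 ^ α * (4 * n + 3)))))
... | divides b refl = 2^α[4n+3]≢2a² n α b (ℕ.*-cancelˡ-≡ _ _ 2 (begin
  2 * (2 ^ α * (4 * n + 3)) ≡⟨ ℕ.*-assoc 2 (2 ^ α) (4 * n + 3) ⟨
  2 ^ suc α * (4 * n + 3)   ≡⟨ eq ⟩
  b * 2 * (b * 2)           ≡⟨ solve 1 (λ b → b :* con 2 :* (b :* con 2)
                                         := con 2 :* (con 2 :* (b :* b))) refl b ⟩
  2 * (2 * (b * b))         ∎))
  where
  open ≡-Reasoning
  open ℕSolver.+-*-Solver

2^α[4n+3]≢2a² n zero    a eq = 4n+3≢2m n (a * a) (trans (sym (ℕ.*-identityˡ _)) eq)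
2^α[4n+3]≢2a² n (suc α) a eq = 2^α[4n+3]≢a² n α a
  (ℕ.*-cancelˡ-≡ _ _ 2 (trans (sym (ℕ.*-assoc 2 (2 ^ α) (4 * n + 3))) eq))

theorem1p6 : ∀ (n i α : ℕ) → 1 ≤ i →
    + 4 ∣ ā (2 * i) (2 ^ α * (4 * n + 3))
-- `2 * suc i` is `2 + 2 * i`, so `4∣ā` is applied with `d = 2 * i`.
theorem1p6 n (suc i) α _ = subst (λ c → + 4 ∣ ā c N) (sym (ℕ.*-suc 2 i))
  (4∣ā (2 * i) N
    (λ a → 2^α[4n+3]≢a² n α a ∘ λ eq → trans eq (cong (_* a) (ℕ.*-identityˡ a)))
    (λ a → 2^α[4n+3]≢2a² n α a ∘ λ eq → trans eq (ℕ.*-assoc 2 a a)))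
  where
  N = 2 ^ α * (4 * n + 3)
  instance
    N≢0 : NonZero N
    N≢0 = ℕ.m*n≢0 (2 ^ α) (4 * n + 3) {{ℕ.m^n≢0 2 α}}
      {{ℕ.>-nonZero (ℕ.≤-trans (s≤s z≤n) (ℕ.m≤n+m 3 (4 * n)))}}
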